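{- For every prime power $q>5$ there exists a non-cyclotomic orthomorphism over $\mathbb{F}_q$, i.e. $\mathscr{D}_{q-1}(q)\neq\emptyset$.
   Context: Let $\mathbb{F}_q$ be the finite field of order $q$. An orthomorphism is a permutation $\theta$ of $\mathbb{F}_q$ such that $x\mapsto\theta(x)-x$ is also a permutation. For $k\mid(q-1)$, fix a generator $g$ of $\mathbb{F}_q^*$ and let $C_{k,i}=\{g^j: j\equiv i\pmod k\}$, $0\le i<k$ (cyclotomy classes of index $k$). A cyclotomic map of index $k$ with multipliers $[a_0,\dots,a_{k-1}]$ is $\theta(0)=0$, $\theta(x)=a_ix$ for $x\in C_{k,i}$. $\mathscr{C}_k(q)$ is the set of orthomorphisms that are cyclotomic maps of index $k$, and $\mathscr{D}_k(q)=\mathscr{C}_k(q)\setminus\bigcup_{\ell<k,\ \ell\mid(q-1)}\mathscr{C}_\ell(q)$. An orthomorphism in $\mathscr{D}_{q-1}(q)$ is called non-cyclotomic (note $\mathscr{C}_{q-1}(q)$ is the set of all orthomorphisms fixing $0$). -}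

module Defs where

open import Level using (0ℓ)
open import Data.Nat as ℕ using (ℕ; suc; _∸_; _<_; _%_)
open import Data.Nat.Divisibility using (_∣_)
open import Data.Fin using (Fin; fromℕ<)
open import Data.Nat.DivMod using (_mod_)
open import Data.Product using (Σ; ∃; _×_; _,_)
open import Relation.Binary.PropositionalEquality using (_≡_; _≢_)
open import Relation.Nullary using (¬_)
open import Algebra.Structures using (IsCommutativeRing)
open import Function.Definitions using (Bijective)
open import Function.Bundles using (_↔_)

record FiniteField (q : ℕ) : Set₁ where
  field
    Carrier : Set
    _+_ _*_ : Carrier → Carrier → Carrier
    -_      : Carrier → Carrier
    0# 1#   : Carrier
    isCommutativeRing : IsCommutativeRing _≡_ _+_ _*_ -_ 0# 1#
    0≢1     : 0# ≢ 1#
    inverse : ∀ x → x ≢ 0# → ∃ λ y → x * y ≡ 1#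
    finite  : Carrier ↔ Fin q

  _-_ : Carrier → Carrier → Carrier
  x - y = x + (- y)

  _^_ : Carrier → ℕ → Carrier
  x ^ ℕ.zero = 1#
  x ^ suc n  = x * (x ^ n)

module _ {q : ℕ} (F : FiniteField q) where
  open FiniteField F

  IsOrthomorphism : (Carrier → Carrier) → Set
  IsOrthomorphism θ = Bijective _≡_ _≡_ θ × Bijective _≡_ _≡_ (λ x → θ x - x)

  IsGenerator : Carrier → Set
  IsGenerator g = g ≢ 0# × (∀ x → x ≢ 0# → ∃ λ j → g ^ j ≡ x)

  IsCyclotomic : (g : Carrier) (k : ℕ) → .{{_ : ℕ.NonZero k}} → (Carrier → Carrier) → Set
  IsCyclotomic g k θ =
    θ 0# ≡ 0# ×
    Σ (Fin k → Carrier) λ a →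
      ∀ (j : ℕ) → θ (g ^ j) ≡ a (j mod k) * (g ^ j)

  InC : (g : Carrier) (k : ℕ) → .{{_ : ℕ.NonZero k}} → (Carrier → Carrier) → Set
  InC g k θ = IsOrthomorphism θ × IsCyclotomic g k θ

  InD : (g : Carrier) (k : ℕ) → .{{_ : ℕ.NonZero k}} → (Carrier → Carrier) → Set
  InD g k θ = InC g k θ ×
    (∀ (ℓ : ℕ) .{{_ : ℕ.NonZero ℓ}} → ℓ ∣ (q ∸ 1) → ℓ < k → ¬ InC g ℓ θ)

pred-nonZero : ∀ {q} → 5 < q → ℕ.NonZero (q ∸ 1)
pred-nonZero {suc (suc q)} _ = _
pred-nonZero {suc ℕ.zero} (ℕ.s≤s ())

{-# OPTIONS --safe #-}

-- A map of index ℓ commutes with multiplication by g ^ ℓ, which is not 1 when ℓ < q − 1.  So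
-- it suffices to find an orthomorphism θ fixing 0 that commutes with no multiplication by
-- h ∉ {0, 1}.
--
-- If 1 + 1 = 0, pick a ∉ {0, 1}, let V = {0, 1, a, a + 1} and pick c ∉ V (possible since q > 4).
-- Take θ x = a x + a (a + 1) on c + V and θ x = a x elsewhere: a collision a x + a (a + 1) = a y
-- means y = x + (a + 1), which lies in the same coset of V as x, and similarly for θ x − x.
-- If θ (h c) = h θ c, then h a (a + 1) is a (a + 1) or 0, according to whether h c ∈ c + V, so
-- h ∈ {0, 1}.
--
-- If 1 + 1 ≠ 0, then q ≥ 7, so two of the at least five elements of F ∖ {0, 1}, say a ≠ b, agree
-- both in the quadratic character of a, b and in that of a − 1, b − 1.  Multiplying squares by a
-- and non-squares by b is then an orthomorphism φ, and θ x = φ (x + 1) − φ 1 is one that fixes 0.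
-- If θ commutes with h ≠ 0, evaluating at x = y − 1 for a non-square y gives h = 1.

module Submission where

open import Defs
open import Algebra.Bundles using (CommutativeRing)
import Algebra.Properties.Group as GroupProperties
import Algebra.Properties.Ring as RingProperties
import Algebra.Solver.Ring.NaturalCoefficients.Default as SemiringSolver
open import Data.Bool using (if_then_else_)
open import Data.Empty using (⊥)
open import Data.Fin as Fin using (Fin; zero; suc; toℕ; join; combine)
import Data.Fin.Properties as Fin
open import Data.Nat as ℕ using (ℕ; zero; suc; _∸_; _<_; _≤_; s≤s; z≤n)
open import Data.Nat.DivMod using (_mod_; _%_; m≡m%n+[m/n]*n; m%n<n; [m+n]%n≡m%n)
import Data.Nat.Properties as ℕ
open import Data.Product using (∃; ∃₂; _×_; _,_; proj₁; proj₂)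
open import Data.Sum using (_⊎_; inj₁; inj₂; [_,_]′)
open import Data.Sum.Properties using (inj₂-injective)
open import Data.Vec using (Vec; []; _∷_; lookup)
open import Function.Bundles using (Inverse)
open import Function.Definitions using (Injective; Bijective)
open import Relation.Binary.PropositionalEquality
open import Relation.Nullary using (¬_; Dec; yes; no; does; contradiction)
open import Relation.Nullary.Decidable using (map′; dec-true; dec-false; ¬?; _⊎-dec_)

-- Maps defined by cases on a decidable predicate.

module _ {A B : Set} {P : A → Set} where

  piecewise : (∀ x → Dec (P x)) → (A → B) → (A → B) → A → B
  piecewise P? f g x = if does (P? x) then f x else g x

  module _ (P? : ∀ x → Dec (P x)) {f g : A → B} where

    piecewise-yes : ∀ {x} → P x → piecewise P? f g x ≡ f x
    piecewise-yes {x} p = cong (if_then f x else g x) (dec-true (P? x) p)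

    piecewise-no : ∀ {x} → ¬ P x → piecewise P? f g x ≡ g x
    piecewise-no {x} ¬p = cong (if_then f x else g x) (dec-false (P? x) ¬p)

    piecewise-injective : Injective _≡_ _≡_ f → Injective _≡_ _≡_ g →
      (∀ {x y} → P x → ¬ P y → f x ≢ g y) → Injective _≡_ _≡_ (piecewise P? f g)
    piecewise-injective f-inj g-inj f≢g {x} {y} eq with P? x | P? y
    ... | yes p | yes p′ = f-inj eq
    ... | yes p | no ¬p′ = contradiction eq (f≢g p ¬p′)
    ... | no ¬p | yes p′ = contradiction (sym eq) (f≢g p′ ¬p)
    ... | no ¬p | no ¬p′ = g-inj eq

  -- Lets an identity between two maps split along the same predicate be checked branch by branch;
  -- used to identify the difference maps `θ x - x`.
  piecewise-relate : ∀ (P? : ∀ x → Dec (P x)) {f f′ g g′ : A → B} (R : B → B → Set) x →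
    R (f x) (f′ x) → R (g x) (g′ x) → R (piecewise P? f g x) (piecewise P? f′ g′ x)
  piecewise-relate P? R x fRf′ gRg′ with P? x
  ... | yes _ = fRf′
  ... | no _  = gRg′

-- Turns a decision into a number, so that agreement of quadratic characters becomes an equality to
-- which the pigeonhole principle applies.
bit : ∀ {P : Set} → Dec P → Fin 2
bit (yes _) = zero
bit (no _)  = suc zero

-- Counting and arithmetic in a finite field.

module FieldProperties {q : ℕ} (F : FiniteField q) where
  open FiniteField F public

  commutativeRing : CommutativeRing _ _
  commutativeRing = record { isCommutativeRing = isCommutativeRing }

  open CommutativeRing commutativeRing public using
    ( +-assoc; +-comm; +-identityʳ; +-identityˡ; -‿inverseʳ; -‿inverseˡ
    ; *-assoc; *-comm; *-identityʳ; *-identityˡ; distribˡ; zeroʳ )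
  open CommutativeRing commutativeRing using (+-group; ring; commutativeSemiring)
  open GroupProperties +-group public using ()
    renaming (∙-cancelˡ to +-cancelˡ; ∙-cancelʳ to +-cancelʳ; ⁻¹-involutive to -‿involutive)
  open RingProperties ring public using (-‿distribˡ-*)
  open SemiringSolver commutativeSemiring public using (solve; con; _:+_; _:*_; _:=_)

  open Inverse finite using (to; from; strictlyInverseˡ; strictlyInverseʳ)

  from-to : ∀ x → from (to x) ≡ x
  from-to = strictlyInverseʳ

  to-injective : ∀ {x y} → to x ≡ to y → x ≡ y
  to-injective {x} {y} eq = trans (sym (from-to x)) (trans (cong from eq) (from-to y))

  from-injective : ∀ {i j} → from i ≡ from j → i ≡ j
  from-injective {i} {j} eq =
    trans (sym (strictlyInverseˡ i)) (trans (cong to eq) (strictlyInverseˡ j))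

  _≟_ : (x y : Carrier) → Dec (x ≡ y)
  x ≟ y = map′ to-injective (cong to) (to x Fin.≟ to y)

  any? : {P : Carrier → Set} → (∀ x → Dec (P x)) → Dec (∃ P)
  any? {P} P? = map′ (λ (i , p) → from i , p)
                     (λ (x , p) → to x , subst P (sym (from-to x)) p)
                     (Fin.any? (λ i → P? (from i)))

  -- A missed value `y` could be added to the image of `f` as one more point, giving an injection
  -- `h` from `q + 1` elements into `q`.
  injective⇒bijective : ∀ {f} → Injective _≡_ _≡_ f → Bijective _≡_ _≡_ f
  injective⇒bijective {f} f-inj = f-inj , λ y → hit y (any? (λ x → f x ≟ y))
    where
    hit : ∀ y → Dec (∃ λ x → f x ≡ y) → ∃ λ x → ∀ {z} → z ≡ x → f z ≡ y
    hit y (yes (x , fx≡y)) = x , λ { refl → fx≡y }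
    hit y (no missed) = contradiction (Fin.injective⇒≤ {f = h} h-inj) ℕ.1+n≰n
      where
      h : Fin (suc q) → Fin q
      h zero    = to y
      h (suc i) = to (f (from i))

      h-inj : Injective _≡_ _≡_ h
      h-inj {zero}  {zero}  eq = refl
      h-inj {zero}  {suc j} eq = contradiction (from j , sym (to-injective eq)) missed
      h-inj {suc i} {zero}  eq = contradiction (from i , to-injective eq) missed
      h-inj {suc i} {suc j} eq = cong suc (from-injective (f-inj (to-injective eq)))

  -- Choosing an index for each element is injective, since the index determines the element.
  covering⇒≤ : ∀ {k} (v : Fin k → Carrier) → (∀ x → ∃ λ i → v i ≡ x) → q ≤ k
  covering⇒≤ v cover = Fin.injective⇒≤ {f = λ i → proj₁ (cover (from i))} λ {i} {j} eq →
    from-injective (trans (sym (proj₂ (cover (from i))))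
                   (trans (cong v eq) (proj₂ (cover (from j)))))

  fresh : ∀ {k} (v : Vec Carrier k) → k < q → ∃ λ x → ∀ i → lookup v i ≢ x
  fresh {k} v k<q with any? (λ x → Fin.all? (λ i → ¬? (lookup v i ≟ x)))
  ... | yes found = found
  ... | no none = contradiction (covering⇒≤ (lookup v) covered) (ℕ.<⇒≱ k<q)
    where
    covered : ∀ x → ∃ λ i → lookup v i ≡ x
    covered x with Fin.any? (λ i → lookup v i ≟ x)
    ... | yes p = p
    ... | no ¬p = contradiction (x , λ i eq → ¬p (i , eq)) none

  *-cancelˡ : ∀ {x y z} → x ≢ 0# → x * y ≡ x * z → y ≡ z
  *-cancelˡ {x} {y} {z} x≢0 eq = trans (sym (unfold y)) (trans (cong (x⁻¹ *_) eq) (unfold z))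
    where
    x⁻¹ = proj₁ (inverse x x≢0)

    unfold : ∀ w → x⁻¹ * (x * w) ≡ w
    unfold w = begin
      x⁻¹ * (x * w)  ≡⟨ *-assoc x⁻¹ x w ⟨
      (x⁻¹ * x) * w  ≡⟨ cong (_* w) (trans (*-comm x⁻¹ x) (proj₂ (inverse x x≢0))) ⟩
      1# * w         ≡⟨ *-identityˡ w ⟩
      w              ∎
      where open ≡-Reasoning

  *-cancelʳ : ∀ {x y z} → x ≢ 0# → y * x ≡ z * x → y ≡ z
  *-cancelʳ {x} {y} {z} x≢0 eq =
    *-cancelˡ x≢0 (trans (*-comm x y) (trans eq (*-comm z x)))

  *-nonzero : ∀ {x y} → x ≢ 0# → y ≢ 0# → x * y ≢ 0#
  *-nonzero {x} x≢0 y≢0 eq = y≢0 (*-cancelˡ x≢0 (trans eq (sym (zeroʳ x))))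

  ^-nonzero : ∀ {x} → x ≢ 0# → ∀ n → x ^ n ≢ 0#
  ^-nonzero x≢0 zero    = λ eq → 0≢1 (sym eq)
  ^-nonzero x≢0 (suc n) = *-nonzero x≢0 (^-nonzero x≢0 n)

  ^-homo-+ : ∀ x m n → x ^ (m ℕ.+ n) ≡ (x ^ m) * (x ^ n)
  ^-homo-+ x zero    n = sym (*-identityˡ _)
  ^-homo-+ x (suc m) n = trans (cong (x *_) (^-homo-+ x m n)) (sym (*-assoc x _ _))

  ^-assoc : ∀ x m n → (x ^ m) ^ n ≡ x ^ (n ℕ.* m)
  ^-assoc x m zero    = refl
  ^-assoc x m (suc n) = trans (cong ((x ^ m) *_) (^-assoc x m n)) (sym (^-homo-+ x m (n ℕ.* m)))

  1^ : ∀ n → 1# ^ n ≡ 1#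
  1^ zero    = refl
  1^ (suc n) = trans (*-identityˡ _) (1^ n)

  ^-% : ∀ {x} m .{{_ : ℕ.NonZero m}} → x ^ m ≡ 1# → ∀ j → x ^ (j % m) ≡ x ^ j
  ^-% {x} m xᵐ≡1 j = begin
    x ^ (j % m)                              ≡⟨ *-identityʳ _ ⟨
    (x ^ (j % m)) * 1#                       ≡⟨ cong ((x ^ (j % m)) *_) (1^ (j ℕ./ m)) ⟨
    (x ^ (j % m)) * (1# ^ (j ℕ./ m))         ≡⟨ cong (λ y → (x ^ (j % m)) * (y ^ (j ℕ./ m))) xᵐ≡1 ⟨
    (x ^ (j % m)) * ((x ^ m) ^ (j ℕ./ m))    ≡⟨ cong ((x ^ (j % m)) *_) (^-assoc x m (j ℕ./ m)) ⟩
    (x ^ (j % m)) * (x ^ ((j ℕ./ m) ℕ.* m))  ≡⟨ ^-homo-+ x (j % m) _ ⟨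
    x ^ (j % m ℕ.+ (j ℕ./ m) ℕ.* m)          ≡⟨ cong (x ^_) (m≡m%n+[m/n]*n j m) ⟨
    x ^ j                                    ∎
    where open ≡-Reasoning

  x+y+y≡x : 1# + 1# ≡ 0# → ∀ x y → (x + y) + y ≡ x
  x+y+y≡x 2≡0 x y = begin
    (x + y) + y          ≡⟨ solve 2 (λ x y → (x :+ y) :+ y := x :+ y :* (con 1 :+ con 1)) refl x y ⟩
    x + (y * (1# + 1#))  ≡⟨ cong (λ t → x + (y * t)) 2≡0 ⟩
    x + (y * 0#)         ≡⟨ cong (x +_) (zeroʳ y) ⟩
    x + 0#               ≡⟨ +-identityʳ x ⟩
    x                    ∎
    where open ≡-Reasoning

  -- The semiring solver sees a negative only as an atom; this cancellation and the next remove
  -- negatives around its calls.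
  x-y+y≡x : ∀ x y → (x + (- y)) + y ≡ x
  x-y+y≡x x y = trans (+-assoc x (- y) y) (trans (cong (x +_) (-‿inverseˡ y)) (+-identityʳ x))

  x+y-y≡x : ∀ x y → (x + y) + (- y) ≡ x
  x+y-y≡x x y = trans (+-assoc x y (- y)) (trans (cong (x +_) (-‿inverseʳ y)) (+-identityʳ x))

  -- Criteria for orthomorphisms and for being non-cyclotomic.

  -- By finiteness injectivity is enough, and `η` is the difference map, introduced by an equation
  -- without subtraction.
  injections⇒orthomorphism : ∀ {θ η} → Injective _≡_ _≡_ θ → Injective _≡_ _≡_ η →
    (∀ x → θ x ≡ η x + x) → IsOrthomorphism F θ
  injections⇒orthomorphism {θ} {η} θ-inj η-inj θ≡η+ =
    injective⇒bijective θ-inj ,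
    injective⇒bijective λ {x} {y} eq → η-inj (trans (sym (diff x)) (trans eq (diff y)))
    where
    diff : ∀ x → θ x - x ≡ η x
    diff x = trans (cong (_+ (- x)) (θ≡η+ x)) (x+y-y≡x (η x) x)

  NonHomogeneous : (Carrier → Carrier) → Set
  NonHomogeneous θ = ∀ h → h ≢ 0# → h ≢ 1# → ¬ (∀ x → θ (h * x) ≡ h * θ x)

  -- Powers of a generator and cyclotomic maps.

  module Cyclic {g : Carrier} (g-gen : IsGenerator F g) where

    g≢0 : g ≢ 0#
    g≢0 = proj₁ g-gen

    -- Exponents reduce modulo `m`, so 0 and the first `m` powers of `g` cover the field.
    ^≡1⇒q≤1+ : ∀ m .{{_ : ℕ.NonZero m}} → g ^ m ≡ 1# → q ≤ suc m
    ^≡1⇒q≤1+ m gᵐ≡1 = covering⇒≤ v cover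
      where
      v : Fin (suc m) → Carrier
      v zero    = 0#
      v (suc i) = g ^ toℕ i

      cover : ∀ x → ∃ λ i → v i ≡ x
      cover x with x ≟ 0#
      ... | yes x≡0 = zero , sym x≡0
      ... | no  x≢0 with proj₂ g-gen x x≢0
      ... | j , gʲ≡x = suc (j mod m) ,
        trans (cong (g ^_) (Fin.toℕ-fromℕ< (m%n<n j m))) (trans (^-% m gᵐ≡1 j) gʲ≡x)

    -- Among 0 and `g ^ 0`, ..., `g ^ (q ∸ 1)` two of the `q + 1` entries coincide. Neither is 0, so
    -- `g ^ d ≡ 1` for some positive `d ≤ q ∸ 1`, and the previous bound forces equality.
    g^[q-1]≡1 : g ^ (q ∸ 1) ≡ 1#
    g^[q-1]≡1 with Fin.pigeonhole ℕ.≤-refl v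
      where
      v : Fin (suc q) → Fin q
      v zero    = to 0#
      v (suc i) = to (g ^ toℕ i)
    ... | zero  , suc j , _ , eq = contradiction (sym (to-injective eq)) (^-nonzero g≢0 (toℕ j))
    ... | suc i , suc j , s≤s i<j , eq =
      trans (cong (g ^_) (ℕ.≤-antisym q-1≤d d≤q-1)) gᵈ≡1
      where
      d = toℕ j ∸ toℕ i

      gᵈ≡1 : g ^ d ≡ 1#
      gᵈ≡1 = *-cancelˡ (^-nonzero g≢0 (toℕ i)) (begin
        (g ^ toℕ i) * (g ^ d)  ≡⟨ ^-homo-+ g (toℕ i) d ⟨
        g ^ (toℕ i ℕ.+ d)      ≡⟨ cong (g ^_) (ℕ.m+[n∸m]≡n (ℕ.<⇒≤ i<j)) ⟩
        g ^ toℕ j              ≡⟨ to-injective eq ⟨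
        g ^ toℕ i              ≡⟨ *-identityʳ _ ⟨
        (g ^ toℕ i) * 1#       ∎)
        where open ≡-Reasoning

      d≤q-1 : d ≤ q ∸ 1
      d≤q-1 = ℕ.≤-trans (ℕ.m∸n≤m (toℕ j) (toℕ i)) (ℕ.pred-mono-≤ (Fin.toℕ<n j))

      q-1≤d : q ∸ 1 ≤ d
      q-1≤d = ℕ.pred-mono-≤ (^≡1⇒q≤1+ d {{ℕ.>-nonZero (ℕ.m<n⇒0<n∸m i<j)}} gᵈ≡1)

    x^[q-1]≡1 : ∀ x → x ≢ 0# → x ^ (q ∸ 1) ≡ 1#
    x^[q-1]≡1 x x≢0 with proj₂ g-gen x x≢0
    ... | j , refl = begin
      (g ^ j) ^ (q ∸ 1)    ≡⟨ ^-assoc g j (q ∸ 1) ⟩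
      g ^ ((q ∸ 1) ℕ.* j)  ≡⟨ cong (g ^_) (ℕ.*-comm (q ∸ 1) j) ⟩
      g ^ (j ℕ.* (q ∸ 1))  ≡⟨ ^-assoc g (q ∸ 1) j ⟨
      (g ^ (q ∸ 1)) ^ j    ≡⟨ cong (_^ j) g^[q-1]≡1 ⟩
      1# ^ j               ≡⟨ 1^ j ⟩
      1#                   ∎
      where open ≡-Reasoning

    -- At index `q ∸ 1` every class is a single element `g ^ n`, so the quotient of `θ (g ^ n)` by
    -- `g ^ n` serves as its multiplier.
    fixing-0⇒cyclotomic : .{{_ : ℕ.NonZero (q ∸ 1)}} → ∀ {θ} → θ 0# ≡ 0# →
      IsCyclotomic F g (q ∸ 1) θ
    fixing-0⇒cyclotomic {θ} θ0≡0 = θ0≡0 , a , eq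
      where
      inv : ∀ n → Carrier
      inv n = proj₁ (inverse (g ^ n) (^-nonzero g≢0 n))

      a : Fin (q ∸ 1) → Carrier
      a i = θ (g ^ toℕ i) * inv (toℕ i)

      eq : ∀ j → θ (g ^ j) ≡ a (j mod (q ∸ 1)) * (g ^ j)
      eq j = begin
        θ (g ^ j)                        ≡⟨ cong θ red ⟨
        θ (g ^ n)                        ≡⟨ *-identityʳ _ ⟨
        θ (g ^ n) * 1#                   ≡⟨ cong (θ (g ^ n) *_) (proj₂ (inverse (g ^ n) _)) ⟨
        θ (g ^ n) * ((g ^ n) * inv n)    ≡⟨ cong (θ (g ^ n) *_) (*-comm _ _) ⟩
        θ (g ^ n) * (inv n * (g ^ n))    ≡⟨ *-assoc _ _ _ ⟨
        (θ (g ^ n) * inv n) * (g ^ n)    ≡⟨ cong ((θ (g ^ n) * inv n) *_) red ⟩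
        (θ (g ^ n) * inv n) * (g ^ j)    ∎
        where
        open ≡-Reasoning
        n = toℕ (j mod (q ∸ 1))

        red : g ^ n ≡ g ^ j
        red = trans (cong (g ^_) (Fin.toℕ-fromℕ< (m%n<n j (q ∸ 1)))) (^-% (q ∸ 1) g^[q-1]≡1 j)

    -- Raising the exponent by `ℓ` stays in the same class, so the multiplier does not change.
    cyclotomic⇒homogeneous : ∀ ℓ .{{_ : ℕ.NonZero ℓ}} {θ} → IsCyclotomic F g ℓ θ →
      ∀ x → θ ((g ^ ℓ) * x) ≡ (g ^ ℓ) * θ x
    cyclotomic⇒homogeneous ℓ {θ} (θ0≡0 , a , θ-eq) x with x ≟ 0#
    ... | yes refl = trans (cong θ (zeroʳ _)) (trans θ0≡0 (sym (trans (cong (_ *_) θ0≡0) (zeroʳ _))))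
    ... | no x≢0 with proj₂ g-gen x x≢0
    ... | j , refl = begin
      θ ((g ^ ℓ) * (g ^ j))                   ≡⟨ cong θ (^-homo-+ g ℓ j) ⟨
      θ (g ^ (ℓ ℕ.+ j))                       ≡⟨ θ-eq (ℓ ℕ.+ j) ⟩
      a ((ℓ ℕ.+ j) mod ℓ) * (g ^ (ℓ ℕ.+ j))   ≡⟨ cong₂ (λ i y → a i * y) same (^-homo-+ g ℓ j) ⟩
      a (j mod ℓ) * ((g ^ ℓ) * (g ^ j))       ≡⟨ solve 3 (λ x y z → x :* (y :* z) := y :* (x :* z))
                                                   refl (a (j mod ℓ)) (g ^ ℓ) (g ^ j) ⟩
      (g ^ ℓ) * (a (j mod ℓ) * (g ^ j))       ≡⟨ cong (_ *_) (θ-eq j) ⟨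
      (g ^ ℓ) * θ (g ^ j)                     ∎
      where
      open ≡-Reasoning
      same : (ℓ ℕ.+ j) mod ℓ ≡ j mod ℓ
      same = Fin.fromℕ<-cong _ _ (trans (cong (_% ℓ) (ℕ.+-comm ℓ j)) ([m+n]%n≡m%n j ℓ))
               (m%n<n (ℓ ℕ.+ j) ℓ) (m%n<n j ℓ)

    nonHomogeneous⇒InD : .{{_ : ℕ.NonZero (q ∸ 1)}} → ∀ {θ} → IsOrthomorphism F θ →
      θ 0# ≡ 0# → NonHomogeneous θ → InD F g (q ∸ 1) θ
    nonHomogeneous⇒InD {θ} θ-orth θ0≡0 non =
      (θ-orth , fixing-0⇒cyclotomic {θ} θ0≡0) ,
      λ ℓ _ ℓ<q-1 (_ , θ-cyc) → non (g ^ ℓ) (^-nonzero g≢0 ℓ)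
        (λ gˡ≡1 → ℕ.<⇒≱ ℓ<q-1 (ℕ.pred-mono-≤ (^≡1⇒q≤1+ ℓ gˡ≡1)))
        (cyclotomic⇒homogeneous ℓ {θ} θ-cyc)

  -- Characteristic 2: shifting a linear map on a coset.

  module Characteristic2 (2≡0 : 1# + 1# ≡ 0#) {a c : Carrier} (a≢0 : a ≢ 0#) (a≢1 : a ≢ 1#)
    (c≢0 : c ≢ 0#) (c≢1 : c ≢ 1#) (c≢a : c ≢ a) (c≢a+1 : c ≢ a + 1#) where

    -- `e` is the multiplier of the difference map, since `a - 1 = a + 1` here. The shift `u` is
    -- `a * e` and also `e * a`, which suits both maps at once.
    e u : Carrier
    e = a + 1#
    u = a * e

    x+y≡0⇒x≡y : ∀ {x y} → x + y ≡ 0# → x ≡ y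
    x+y≡0⇒x≡y {x} {y} eq =
      trans (sym (x+y+y≡x 2≡0 x y)) (trans (cong (_+ y) eq) (+-identityˡ y))

    e≢0 : e ≢ 0#
    e≢0 eq = a≢1 (x+y≡0⇒x≡y eq)

    -- The coset `c + V`, listed in pairs: adding 1 swaps the members of each pair, and adding `a`
    -- exchanges the pairs.
    S : Carrier → Set
    S x = (x ≡ c ⊎ x ≡ c + 1#) ⊎ (x ≡ c + a ⊎ x ≡ c + e)

    S? : ∀ x → Dec (S x)
    S? x = ((x ≟ c) ⊎-dec (x ≟ (c + 1#))) ⊎-dec ((x ≟ (c + a)) ⊎-dec (x ≟ (c + e)))

    S-+1 : ∀ {x} → S x → S (x + 1#)
    S-+1 (inj₁ (inj₁ refl)) = inj₁ (inj₂ refl)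
    S-+1 (inj₁ (inj₂ refl)) = inj₁ (inj₁ (x+y+y≡x 2≡0 c 1#))
    S-+1 (inj₂ (inj₁ refl)) = inj₂ (inj₂ (+-assoc c a 1#))
    S-+1 (inj₂ (inj₂ refl)) =
      inj₂ (inj₁ (trans (cong (_+ 1#) (sym (+-assoc c a 1#))) (x+y+y≡x 2≡0 (c + a) 1#)))

    S-+a : ∀ {x} → S x → S (x + a)
    S-+a (inj₁ (inj₁ refl)) = inj₂ (inj₁ refl)
    S-+a (inj₁ (inj₂ refl)) = inj₂ (inj₂ (trans (+-assoc c 1# a) (cong (c +_) (+-comm 1# a))))
    S-+a (inj₂ (inj₁ refl)) = inj₁ (inj₁ (x+y+y≡x 2≡0 c a))
    S-+a (inj₂ (inj₂ refl)) =
      inj₁ (inj₂ (trans (cong (λ t → (c + t) + a) (+-comm a 1#))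
                 (trans (cong (_+ a) (sym (+-assoc c 1# a))) (x+y+y≡x 2≡0 (c + 1#) a))))

    S-+e : ∀ {x} → S x → S (x + e)
    S-+e {x} s = subst S (+-assoc x a 1#) (S-+1 (S-+a s))

    0∉S : ¬ S 0#
    0∉S (inj₁ (inj₁ eq)) = c≢0 (sym eq)
    0∉S (inj₁ (inj₂ eq)) = c≢1 (x+y≡0⇒x≡y (sym eq))
    0∉S (inj₂ (inj₁ eq)) = c≢a (x+y≡0⇒x≡y (sym eq))
    0∉S (inj₂ (inj₂ eq)) = c≢a+1 (x+y≡0⇒x≡y (sym eq))

    -- The common form of `θ`, with `k = a`, and of its difference map, with `k = e`.
    shear : Carrier → Carrier → Carrier
    shear k = piecewise S? (λ x → (k * x) + u) (k *_)

    -- A collision between the branches means `y = x + t`, which keeps `y` in `S`. For `k = a` the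
    -- translation `t` is `e`, and for `k = e` it is `a`.
    shear-injective : ∀ {k t} → k ≢ 0# → k * t ≡ u → (∀ {x} → S x → S (x + t)) →
      Injective _≡_ _≡_ (shear k)
    shear-injective {k} {t} k≢0 kt≡u S-+t = piecewise-injective S?
      (λ {x} {y} eq → *-cancelˡ k≢0 (+-cancelʳ u (k * x) (k * y) eq))
      (*-cancelˡ k≢0)
      λ {x} {y} x∈S y∉S eq → y∉S (subst S
        (*-cancelˡ k≢0 (trans (distribˡ k x t) (trans (cong ((k * x) +_) kt≡u) eq)))
        (S-+t x∈S))

    θ : Carrier → Carrier
    θ = shear a

    θ-on : ∀ {x} → S x → θ x ≡ (a * x) + u
    θ-on = piecewise-yes S? {λ x → (a * x) + u} {a *_}

    θ-off : ∀ {x} → ¬ S x → θ x ≡ a * x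
    θ-off = piecewise-no S? {λ x → (a * x) + u} {a *_}

    -- Two added copies of `x` cancel; one of them is absorbed into the multiplier, turning `a` into
    -- `e`.
    θ-split : ∀ x → θ x ≡ shear e x + x
    θ-split x = piecewise-relate S?
      {λ x → (a * x) + u} {λ x → (e * x) + u} {a *_} {e *_} (λ y z → y ≡ z + x) x
      (begin
        (a * x) + u                ≡⟨ x+y+y≡x 2≡0 _ x ⟨
        (((a * x) + u) + x) + x    ≡⟨ cong (_+ x) (solve 3 (λ a x u →
                                        (a :* x :+ u) :+ x := (a :+ con 1) :* x :+ u) refl a x u) ⟩
        ((e * x) + u) + x          ∎)
      (begin
        a * x                      ≡⟨ x+y+y≡x 2≡0 _ x ⟨
        ((a * x) + x) + x          ≡⟨ cong (_+ x) (solve 2 (λ a x →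
                                        a :* x :+ x := (a :+ con 1) :* x) refl a x) ⟩
        (e * x) + x                ∎)
      where open ≡-Reasoning

    θ-orthomorphism : IsOrthomorphism F θ
    θ-orthomorphism = injections⇒orthomorphism
      (shear-injective a≢0 refl S-+e) (shear-injective e≢0 (*-comm e a) S-+a) θ-split

    θ0≡0 : θ 0# ≡ 0#
    θ0≡0 = trans (θ-off 0∉S) (zeroʳ a)

    θ-nonHomogeneous : NonHomogeneous θ
    θ-nonHomogeneous h h≢0 h≢1 hom with S? (h * c)
    -- Both sides carry the shift: `h * u` equals `u`, and `u` can be cancelled.
    ... | yes hc∈S = h≢1 (*-cancelʳ (*-nonzero a≢0 e≢0) (+-cancelˡ (a * (h * c)) _ _ (begin
      (a * (h * c)) + (h * u)    ≡⟨ solve 4 (λ a h c u → a :* (h :* c) :+ h :* u :=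
                                      h :* (a :* c :+ u)) refl a h c u ⟩
      h * ((a * c) + u)          ≡⟨ cong (h *_) (θ-on (inj₁ (inj₁ refl))) ⟨
      h * θ c                    ≡⟨ hom c ⟨
      θ (h * c)                  ≡⟨ θ-on hc∈S ⟩
      (a * (h * c)) + u          ≡⟨ cong ((a * (h * c)) +_) (*-identityˡ u) ⟨
      (a * (h * c)) + (1# * u)   ∎)))
      where open ≡-Reasoning
    -- Only one side carries the shift, so `h * u` would be 0 although both factors are nonzero.
    ... | no hc∉S = *-nonzero h≢0 (*-nonzero a≢0 e≢0) (+-cancelˡ (a * (h * c)) _ _ (begin
      (a * (h * c)) + (h * u)    ≡⟨ solve 4 (λ a h c u → a :* (h :* c) :+ h :* u :=
                                      h :* (a :* c :+ u)) refl a h c u ⟩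
      h * ((a * c) + u)          ≡⟨ cong (h *_) (θ-on (inj₁ (inj₁ refl))) ⟨
      h * θ c                    ≡⟨ hom c ⟨
      θ (h * c)                  ≡⟨ θ-off hc∉S ⟩
      a * (h * c)                ≡⟨ +-identityʳ _ ⟨
      (a * (h * c)) + 0#         ∎))
      where open ≡-Reasoning

  -- Squares and non-squares.

  -- Zero counts as a square, so every non-square is nonzero and two branches suffice for
  -- `quadratic`.
  Square : Carrier → Set
  Square x = ∃ λ s → s * s ≡ x

  Square? : ∀ x → Dec (Square x)
  Square? x = any? (λ s → (s * s) ≟ x)

  square-0 : Square 0#
  square-0 = 0# , zeroʳ 0#

  square-* : ∀ {x y} → Square x → Square y → Square (x * y)
  square-* (s , refl) (t , refl) =
    s * t , solve 2 (λ s t → (s :* t) :* (s :* t) := (s :* s) :* (t :* t)) refl s t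

  square-cancelˡ : ∀ {x y} → x ≢ 0# → Square x → Square (x * y) → Square y
  square-cancelˡ {x} {y} x≢0 (s , s²≡x) (t , t²≡xy) = t * s⁻¹ , *-cancelˡ x≢0 (begin
    x * ((t * s⁻¹) * (t * s⁻¹))          ≡⟨ cong (_* ((t * s⁻¹) * (t * s⁻¹))) s²≡x ⟨
    (s * s) * ((t * s⁻¹) * (t * s⁻¹))    ≡⟨ solve 3 (λ s t r →
                                              (s :* s) :* ((t :* r) :* (t :* r)) :=
                                              (t :* t) :* ((s :* r) :* (s :* r))) refl s t s⁻¹ ⟩
    (t * t) * ((s * s⁻¹) * (s * s⁻¹))    ≡⟨ cong (λ r → (t * t) * (r * r)) (proj₂ s-inverse) ⟩
    (t * t) * (1# * 1#)                  ≡⟨ solve 1 (λ t → t :* (con 1 :* con 1) := t) refl (t * t) ⟩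
    t * t                                ≡⟨ t²≡xy ⟩
    x * y                                ∎)
    where
    open ≡-Reasoning
    s-inverse = inverse s λ { refl → x≢0 (trans (sym s²≡x) (zeroʳ 0#)) }
    s⁻¹ = proj₁ s-inverse

  nonsquare⇒≢0 : ∀ {x} → ¬ Square x → x ≢ 0#
  nonsquare⇒≢0 ¬sq refl = ¬sq square-0

  1≢-1 : 1# + 1# ≢ 0# → 1# ≢ - 1#
  1≢-1 2≢0 eq = 2≢0 (trans (cong (1# +_) eq) (-‿inverseʳ 1#))

  -1*-1≡1 : (- 1#) * (- 1#) ≡ 1#
  -1*-1≡1 = begin
    (- 1#) * (- 1#)  ≡⟨ -‿distribˡ-* 1# (- 1#) ⟨
    - (1# * (- 1#))  ≡⟨ cong -_ (*-identityˡ (- 1#)) ⟩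
    - (- 1#)         ≡⟨ -‿involutive 1# ⟩
    1#               ∎
    where open ≡-Reasoning

  -- A square-root function would be injective, hence surjective, and 1 and −1 could not both be
  -- in its image.
  nonsquare : 1# + 1# ≢ 0# → ∃ λ x → ¬ Square x
  nonsquare 2≢0 with any? (λ x → ¬? (Square? x))
  ... | yes found = found
  ... | no none = contradiction
    (trans (sym (proj₂ (root-surj 1#) refl))
      (trans (cong root (trans (root-preimage 1# (*-identityˡ 1#))
                               (sym (root-preimage (- 1#) -1*-1≡1))))
             (proj₂ (root-surj (- 1#)) refl)))
    (1≢-1 2≢0)
    where
    all-squares : ∀ x → Square x
    all-squares x with Square? x
    ... | yes sq = sq
    ... | no ¬sq = contradiction (x , ¬sq) none

    root : Carrier → Carrier
    root x = proj₁ (all-squares x)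

    root-surj = proj₂ (injective⇒bijective {root} λ {x} {y} eq →
      trans (sym (proj₂ (all-squares x))) (trans (cong (λ r → r * r) eq) (proj₂ (all-squares y))))

    root-preimage : ∀ y → y * y ≡ 1# → proj₁ (root-surj y) ≡ 1#
    root-preimage y y²≡1 = trans (sym (proj₂ (all-squares (proj₁ (root-surj y)))))
      (trans (cong (λ r → r * r) (proj₂ (root-surj y) refl)) y²≡1)

  -- Characteristic other than 2: quadratic maps and their translates.

  module Odd {g : Carrier} (g-gen : IsGenerator F g) (2≢0 : 1# + 1# ≢ 0#) where
    open Cyclic g-gen

    -- For `q = 6` the exponent `q ∸ 1` is odd, so raising -1 to it would give both 1 and -1. This
    -- lifts `5 < q` to the `6 < q` that the pigeonhole argument requires.
    6≢q : 6 ≢ q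
    6≢q refl = 1≢-1 2≢0 (trans (sym (x^[q-1]≡1 (- 1#) -1≢0)) (begin
      n * (n * (n * (n * (n * 1#))))    ≡⟨ solve 1 (λ n → n :* (n :* (n :* (n :* (n :* con 1)))) :=
                                             (n :* n) :* (n :* n) :* n) refl n ⟩
      ((n * n) * (n * n)) * n           ≡⟨ cong (λ t → (t * t) * n) -1*-1≡1 ⟩
      (1# * 1#) * n                     ≡⟨ solve 1 (λ n → con 1 :* con 1 :* n := n) refl n ⟩
      n                                 ∎))
      where
      open ≡-Reasoning
      n = - 1#

      -1≢0 : n ≢ 0#
      -1≢0 eq = 0≢1 (trans (sym (zeroʳ n)) (trans (cong (n *_) (sym eq)) -1*-1≡1))

    -- Each further factor `g` switches the alternative, as `g * (g * (s * s))` is the square of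
    -- `g * s`.
    ^-square-or-g*square : ∀ j → Square (g ^ j) ⊎ ∃ λ s → g ^ j ≡ g * (s * s)
    ^-square-or-g*square zero = inj₁ (1# , *-identityˡ 1#)
    ^-square-or-g*square (suc j) with ^-square-or-g*square j
    ... | inj₁ (s , eq) = inj₂ (s , cong (g *_) (sym eq))
    ... | inj₂ (s , eq) = inj₁ (g * s , trans
      (solve 2 (λ g s → (g :* s) :* (g :* s) := g :* (g :* (s :* s))) refl g s)
      (cong (g *_) (sym eq)))

    nonsquare⇒g*square : ∀ {x} → ¬ Square x → ∃ λ s → x ≡ g * (s * s)
    nonsquare⇒g*square {x} ¬sq with proj₂ g-gen x (nonsquare⇒≢0 ¬sq)
    ... | j , refl = [ (λ sq → contradiction sq ¬sq) , (λ p → p) ]′ (^-square-or-g*square j)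

    -- Each factor is `g` times a square, and the two copies of `g` combine into a square.
    nonsquare-* : ∀ {x y} → ¬ Square x → ¬ Square y → Square (x * y)
    nonsquare-* ¬x ¬y with nonsquare⇒g*square ¬x | nonsquare⇒g*square ¬y
    ... | s , refl | t , refl = (g * s) * t , solve 3 (λ g s t →
      (g :* s :* t) :* (g :* s :* t) := (g :* (s :* s)) :* (g :* (t :* t))) refl g s t

    quadratic : Carrier → Carrier → Carrier → Carrier
    quadratic a b = piecewise Square? (a *_) (b *_)

    -- Suppose `a * x ≡ b * y` with `x` a square and `y` not. If `a` and `b` are squares, then so is
    -- `y`. If neither is, then `b * y` is a nonzero square, which makes `a` a square.
    quadratic-injective : ∀ {a b} → a ≢ 0# → b ≢ 0# → bit (Square? a) ≡ bit (Square? b) →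
      Injective _≡_ _≡_ (quadratic a b)
    quadratic-injective {a} {b} a≢0 b≢0 same =
      piecewise-injective Square? (*-cancelˡ a≢0) (*-cancelˡ b≢0) (separate same)
      where
      separate : bit (Square? a) ≡ bit (Square? b) → ∀ {x y} → Square x → ¬ Square y → a * x ≢ b * y
      separate same {x} {y} x-sq y-nsq eq with Square? a | Square? b | same
      ... | yes a-sq | yes b-sq | _ =
        y-nsq (square-cancelˡ b≢0 b-sq (subst Square eq (square-* a-sq x-sq)))
      ... | no a-nsq | no b-nsq | _ = a-nsq (square-cancelˡ x≢0 x-sq
        (subst Square (trans (sym eq) (*-comm a x)) (nonsquare-* b-nsq y-nsq)))
        where
        x≢0 : x ≢ 0#
        x≢0 refl = *-nonzero b≢0 (nonsquare⇒≢0 y-nsq) (trans (sym eq) (zeroʳ a))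

    -- Six pigeonholes: one each for 0 and 1, so that neither takes part in a collision, and four
    -- for the characters of `x` and `x - 1#`, which are multipliers of `φ` and of its difference
    -- map.
    tag : Carrier → Fin 2 ⊎ Fin 4
    tag x with x ≟ 0# | x ≟ 1#
    ... | yes _ | _     = inj₁ zero
    ... | no _  | yes _ = inj₁ (suc zero)
    ... | no _  | no _  = inj₂ (combine (bit (Square? x)) (bit (Square? (x - 1#))))

    tag-collision : ∀ {x y} → x ≢ y → tag x ≡ tag y →
      (x ≢ 0# × x ≢ 1#) × (y ≢ 0# × y ≢ 1#) ×
      bit (Square? x) ≡ bit (Square? y) × bit (Square? (x - 1#)) ≡ bit (Square? (y - 1#))
    tag-collision {x} {y} x≢y eq with x ≟ 0# | x ≟ 1# | y ≟ 0# | y ≟ 1#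
    tag-collision x≢y eq | yes x≡0 | _       | yes y≡0 | _       = contradiction (trans x≡0 (sym y≡0)) x≢y
    tag-collision x≢y () | yes _   | _       | no _    | yes _
    tag-collision x≢y () | yes _   | _       | no _    | no _
    tag-collision x≢y () | no _    | yes _   | yes _   | _
    tag-collision x≢y eq | no _    | yes x≡1 | no _    | yes y≡1 = contradiction (trans x≡1 (sym y≡1)) x≢y
    tag-collision x≢y () | no _    | yes _   | no _    | no _
    tag-collision x≢y () | no _    | no _    | yes _   | _
    tag-collision x≢y () | no _    | no _    | no _    | yes _
    tag-collision x≢y eq | no x≢0  | no x≢1  | no y≢0  | no y≢1  =
      (x≢0 , x≢1) , (y≢0 , y≢1) , Fin.combine-injective _ _ _ _ (inj₂-injective eq)

    multipliers : 6 < q → ∃₂ λ x y → x ≢ y × tag x ≡ tag y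
    multipliers 6<q with Fin.pigeonhole 6<q (λ i → join 2 4 (tag (from i)))
    ... | i , j , i<j , eq = from i , from j ,
      (λ fi≡fj → Fin.<⇒≢ i<j (from-injective fi≡fj)) ,
      trans (sym (Fin.splitAt-join 2 4 _)) (trans (cong (Fin.splitAt 2) eq) (Fin.splitAt-join 2 4 _))

    module Translate {a b : Carrier} (a≢b : a ≢ b) (tags : tag a ≡ tag b) where

      private
        classes = tag-collision a≢b tags
        a≢0 = proj₁ (proj₁ classes)
        a≢1 = proj₂ (proj₁ classes)
        b≢0 = proj₁ (proj₁ (proj₂ classes))
        b≢1 = proj₂ (proj₁ (proj₂ classes))

      x-1≢0 : ∀ {x} → x ≢ 1# → x - 1# ≢ 0#
      x-1≢0 {x} x≢1 eq = x≢1 (trans (sym (x-y+y≡x x 1#)) (trans (cong (_+ 1#) eq) (+-identityˡ 1#)))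

      φ η : Carrier → Carrier
      φ = quadratic a b
      η = quadratic (a - 1#) (b - 1#)

      φ-square : ∀ {x} → Square x → φ x ≡ a * x
      φ-square = piecewise-yes Square? {a *_} {b *_}

      φ-nonsquare : ∀ {x} → ¬ Square x → φ x ≡ b * x
      φ-nonsquare = piecewise-no Square? {a *_} {b *_}

      k*x≡[k-1]*x+x : ∀ k x → k * x ≡ ((k - 1#) * x) + x
      k*x≡[k-1]*x+x k x = trans (cong (_* x) (sym (x-y+y≡x k 1#)))
        (solve 2 (λ m x → (m :+ con 1) :* x := m :* x :+ x) refl (k - 1#) x)

      φ-split : ∀ x → φ x ≡ η x + x
      φ-split x = piecewise-relate Square?
        {a *_} {(a - 1#) *_} {b *_} {(b - 1#) *_} (λ y z → y ≡ z + x) x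
        (k*x≡[k-1]*x+x a x) (k*x≡[k-1]*x+x b x)

      -- `φ` commutes with multiplication by every nonzero square; the translation destroys this
      -- symmetry. Since 1 is a square, `φ 1#` is `a`.
      θ : Carrier → Carrier
      θ x = φ (x + 1#) - a

      -- Writing `φ` as `η` plus the identity leaves the constant `1# - a`, so the difference map is
      -- again a translated quadratic map plus a constant.
      θ-split : ∀ x → θ x ≡ (η (x + 1#) + (1# - a)) + x
      θ-split x = trans (cong (_- a) (φ-split (x + 1#)))
        (solve 3 (λ y x m → (y :+ (x :+ con 1)) :+ m := (y :+ (con 1 :+ m)) :+ x)
          refl (η (x + 1#)) x (- a))

      translate-injective : ∀ {f d} → Injective _≡_ _≡_ f → Injective _≡_ _≡_ (λ x → f (x + 1#) + d)
      translate-injective {f} {d} f-inj {x} {y} eq =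
        +-cancelʳ 1# x y (f-inj (+-cancelʳ d (f (x + 1#)) (f (y + 1#)) eq))

      θ-orthomorphism : IsOrthomorphism F θ
      θ-orthomorphism = injections⇒orthomorphism
        (translate-injective (quadratic-injective a≢0 b≢0 (proj₁ (proj₂ (proj₂ classes)))))
        (translate-injective
          (quadratic-injective (x-1≢0 a≢1) (x-1≢0 b≢1) (proj₂ (proj₂ (proj₂ classes)))))
        θ-split

      θ0≡0 : θ 0# ≡ 0#
      θ0≡0 = begin
        φ (0# + 1#) - a  ≡⟨ cong (λ t → φ t - a) (+-identityˡ 1#) ⟩
        φ 1# - a         ≡⟨ cong (_- a) (φ-square (1# , *-identityˡ 1#)) ⟩
        (a * 1#) - a     ≡⟨ cong (_- a) (*-identityʳ a) ⟩
        a - a            ≡⟨ -‿inverseʳ a ⟩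
        0#               ∎
        where open ≡-Reasoning

      clear-negatives : ∀ {h z w} → z - a ≡ h * (w - a) → z + (h * a) ≡ (h * w) + a
      clear-negatives {h} {z} {w} eq = begin
        z + (h * a)                        ≡⟨ cong (_+ (h * a)) (x-y+y≡x z a) ⟨
        ((z - a) + a) + (h * a)            ≡⟨ cong (λ t → (t + a) + (h * a)) eq ⟩
        ((h * (w - a)) + a) + (h * a)      ≡⟨ solve 3 (λ h v a → h :* v :+ a :+ h :* a :=
                                                h :* (v :+ a) :+ a) refl h (w - a) a ⟩
        (h * ((w - a) + a)) + a            ≡⟨ cong (λ t → (h * t) + a) (x-y+y≡x w a) ⟩
        (h * w) + a                        ∎
        where open ≡-Reasoning

      θ-nonHomogeneous : NonHomogeneous θ
      θ-nonHomogeneous h h≢0 h≢1 hom with nonsquare 2≢0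
      ... | y , y-nsq = go (Square? ((h * x) + 1#))
        where
        open ≡-Reasoning
        -- With this choice `θ x` involves `φ y`, where `φ` multiplies by `b`, while `θ (h * x)`
        -- involves `φ z`.
        x = y - 1#
        z = (h * x) + 1#

        z+h≡hy+1 : z + h ≡ (h * y) + 1#
        z+h≡hy+1 = trans
          (solve 2 (λ h x → h :* x :+ con 1 :+ h := h :* (x :+ con 1) :+ con 1) refl h x)
          (cong (λ t → (h * t) + 1#) (x-y+y≡x y 1#))

        relation : φ z + (h * a) ≡ (h * (b * y)) + a
        relation = clear-negatives (trans (hom x) (cong (λ t → h * (t - a))
          (trans (cong φ (x-y+y≡x y 1#)) (φ-nonsquare y-nsq))))

        go : Dec (Square z) → ⊥
        -- Here `φ z` is `a * z`; substituting for `z + h` leaves `a * (h * y) ≡ b * (h * y)`, hence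
        -- `a ≡ b`.
        go (yes z-sq) = a≢b (*-cancelʳ (*-nonzero h≢0 (nonsquare⇒≢0 y-nsq))
          (+-cancelʳ a _ _ (begin
            (a * (h * y)) + a    ≡⟨ solve 3 (λ a h y → a :* (h :* y) :+ a :=
                                      a :* (h :* y :+ con 1)) refl a h y ⟩
            a * ((h * y) + 1#)   ≡⟨ cong (a *_) z+h≡hy+1 ⟨
            a * (z + h)          ≡⟨ solve 3 (λ a z h → a :* (z :+ h) := a :* z :+ h :* a) refl a z h ⟩
            (a * z) + (h * a)    ≡⟨ cong (_+ (h * a)) (φ-square z-sq) ⟨
            φ z + (h * a)        ≡⟨ relation ⟩
            (h * (b * y)) + a    ≡⟨ solve 4 (λ a b h y → h :* (b :* y) :+ a :=
                                      b :* (h :* y) :+ a) refl a b h y ⟩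
            (b * (h * y)) + a    ∎)))
        -- Here `φ z` is `b * z`; the terms in `y` cancel and leave `h * (a - b) ≡ a - b`.
        go (no z-nsq) = h≢1 (*-cancelʳ d≢0 (trans hd≡d (sym (*-identityˡ d))))
          where
          d = a - b

          b+d≡a : b + d ≡ a
          b+d≡a = trans (+-comm b d) (x-y+y≡x a b)

          d≢0 : d ≢ 0#
          d≢0 d≡0 = a≢b (trans (sym b+d≡a) (trans (cong (b +_) d≡0) (+-identityʳ b)))

          hd≡d : h * d ≡ d
          hd≡d = +-cancelˡ ((b * (h * y)) + b) _ _ (begin
            ((b * (h * y)) + b) + (h * d)  ≡⟨ solve 4 (λ b h y d → b :* (h :* y) :+ b :+ h :* d :=
                                                b :* (h :* y :+ con 1) :+ h :* d) refl b h y d ⟩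
            (b * ((h * y) + 1#)) + (h * d) ≡⟨ cong (λ t → (b * t) + (h * d)) z+h≡hy+1 ⟨
            (b * (z + h)) + (h * d)        ≡⟨ solve 4 (λ b z h d → b :* (z :+ h) :+ h :* d :=
                                                b :* z :+ h :* (b :+ d)) refl b z h d ⟩
            (b * z) + (h * (b + d))        ≡⟨ cong₂ (λ s t → s + (h * t))
                                                (sym (φ-nonsquare z-nsq)) b+d≡a ⟩
            φ z + (h * a)                  ≡⟨ relation ⟩
            (h * (b * y)) + a              ≡⟨ cong ((h * (b * y)) +_) b+d≡a ⟨
            (h * (b * y)) + (b + d)        ≡⟨ solve 4 (λ b h y d → h :* (b :* y) :+ (b :+ d) :=
                                                b :* (h :* y) :+ b :+ d) refl b h y d ⟩
            ((b * (h * y)) + b) + d        ∎)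

-- Choosing the parameters in each characteristic.

theorem3p4 : (q : ℕ) (q>5 : 5 < q) (F : FiniteField q) (g : FiniteField.Carrier F) →
    IsGenerator F g → ∃ λ θ → InD F g (q ∸ 1) {{pred-nonZero q>5}} θ
theorem3p4 q q>5 F g g-gen = construct ((1# + 1#) ≟ 0#)
  where
  open FieldProperties F
  open Cyclic g-gen

  construct : Dec (1# + 1# ≡ 0#) → ∃ λ θ → InD F g (q ∸ 1) {{pred-nonZero q>5}} θ
  construct (yes 2≡0)
    with a , a-fresh ← fresh (0# ∷ 1# ∷ []) (ℕ.≤-trans (s≤s (s≤s (s≤s z≤n))) q>5)
    -- The four listed elements are those of `V`; `5 < q` unfolds to `6 ≤ q`, which weakens to the
    -- required `4 < q`.
    with c , c-fresh ← fresh (0# ∷ 1# ∷ a ∷ (a + 1#) ∷ []) (ℕ.<⇒≤ q>5) =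
    θ , nonHomogeneous⇒InD {{pred-nonZero q>5}} θ-orthomorphism θ0≡0 θ-nonHomogeneous
    where
    open Characteristic2 2≡0
      (≢-sym (a-fresh zero)) (≢-sym (a-fresh (suc zero)))
      (≢-sym (c-fresh zero)) (≢-sym (c-fresh (suc zero)))
      (≢-sym (c-fresh (suc (suc zero)))) (≢-sym (c-fresh (suc (suc (suc zero)))))
  construct (no 2≢0) with a , b , a≢b , tags ← Odd.multipliers g-gen 2≢0
                            (ℕ.≤∧≢⇒< q>5 (Odd.6≢q g-gen 2≢0)) =
    θ , nonHomogeneous⇒InD {{pred-nonZero q>5}} θ-orthomorphism θ0≡0 θ-nonHomogeneous
    where open Odd.Translate g-gen 2≢0 a≢b tags
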